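{- Let $\alpha\geq 2$ be any ordinal and let $X$ be any set. The only zero-dimensional elements in the free algebra $\mathfrak{Fr}_X\mathsf{Drs}_{\alpha}$ are the zero $0$ and the unit $1$.
   Context: For sequences $f,g$ of length $\alpha$ and $i\in\alpha$, write $f\equiv_i g$ iff $f(j)=g(j)$ for all $j\in\alpha\setminus\{i\}$. For a set $V$ of sequences of length $\alpha$, $i\in\alpha$ and $Y\subseteq V$, put $C_i^{[V]}Y=\{f\in V:(\exists g\in Y)\ f\equiv_i g\}$. Let $\mathfrak{P}(V)=\langle \mathcal{P}(V),\cap,\cup,\setminus,\emptyset,V,C_i^{[V]}\rangle_{i\in\alpha}$, where $\setminus$ is complementation relative to $V$; it is an algebra in the signature $\cdot,+,-,0,1,c_i$ $(i\in\alpha)$. $\mathsf{Drs}_\alpha$ is the class of all isomorphic copies of subalgebras of algebras $\mathfrak{P}(V)$ with $\emptyset\neq V\subseteq{}^{\alpha}U$ for some set $U$. The free algebra $\mathfrak{Fr}_X\mathsf{Drs}_\alpha$ is the algebra of all terms in this signature with variables from $X$, modulo the congruence identifying terms $s,t$ iff the equation $s=t$ is valid in $\mathsf{Drs}_\alpha$. An element $a$ of an algebra in this signature is zero-dimensional if $\Delta a=\{i\in\alpha: c_i a\neq a\}$ is empty, i.e. $c_i a=a$ for all $i\in\alpha$. -}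

module Defs where

open import Data.Empty.Polymorphic using (⊥)
open import Data.Fin using (Fin)
import Data.Fin as Fin
open import Data.Fin.Induction using (<-wellFounded)
open import Data.Fin.Properties using (<-isStrictTotalOrder)
open import Data.Nat using (ℕ)
open import Data.Product using (Σ; ∃-syntax; _×_; _,_; proj₁)
open import Data.Sum using (_⊎_; inj₁; inj₂)
open import Function using (_∘_)
open import Function.Definitions using (Bijective)
open import Induction.WellFounded using (WellFounded)
open import Level using (Level; 0ℓ; suc; _⊔_)
open import Relation.Binary using (Rel; IsEquivalence; IsStrictTotalOrder; _Respects_)
open import Relation.Binary.PropositionalEquality
  using (_≡_; _≢_; _≗_; refl; sym; trans)
open import Relation.Nullary using (¬_)
open import Relation.Unary using (Pred; _∈_; _∉_; _⊆_; _≐_; Empty; Satisfiable)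

private
  variable
    a b c e p x : Level

-- An ordinal is represented by a well-ordered type of indices.
record Ordinal (a : Level) : Set (suc a) where
  field
    Index              : Set a
    _<_                : Rel Index a
    isStrictTotalOrder : IsStrictTotalOrder _≡_ _<_
    wf                 : WellFounded _<_

open Ordinal using (Index)

-- α ≤ₒ β: α is isomorphic to an initial segment of β.
record _≤ₒ_ (α : Ordinal a) (β : Ordinal b) : Set (a ⊔ b) where
  open Ordinal α using () renaming (_<_ to _<₁_)
  open Ordinal β using () renaming (_<_ to _<₂_)
  field
    embed   : Index α → Index β
    mono    : ∀ {i j} → i <₁ j → embed i <₂ embed j
    initial : ∀ {i k} → k <₂ embed i → ∃[ j ] (j <₁ i × embed j ≡ k)

finₒ : ℕ → Ordinal 0ℓ
finₒ n = record
  { Index              = Fin n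
  ; _<_                = Fin._<_
  ; isStrictTotalOrder = <-isStrictTotalOrder
  ; wf                 = <-wellFounded
  }

-- The carrier is a setoid, so that the free algebra can be a quotient of the
-- term algebra.
record Algebra (I : Set a) (c e : Level) : Set (a ⊔ suc (c ⊔ e)) where
  infix  4 _≈_
  infixl 7 _·_
  infixl 6 _+_
  infix  8 -_
  field
    Carrier       : Set c
    _≈_           : Rel Carrier e
    _·_           : Carrier → Carrier → Carrier
    _+_           : Carrier → Carrier → Carrier
    -_            : Carrier → Carrier
    𝟘             : Carrier
    𝟙             : Carrier
    cyl           : I → Carrier → Carrier
    isEquivalence : IsEquivalence _≈_
    ·-cong        : ∀ {x x′ y y′} → x ≈ x′ → y ≈ y′ → x · y ≈ x′ · y′
    +-cong        : ∀ {x x′ y y′} → x ≈ x′ → y ≈ y′ → x + y ≈ x′ + y′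
    -‿cong        : ∀ {x x′} → x ≈ x′ → - x ≈ - x′
    cyl-cong      : ∀ i {x x′} → x ≈ x′ → cyl i x ≈ cyl i x′

  Δ : Carrier → Pred I e
  Δ x i = ¬ (cyl i x ≈ x)

  ZeroDimensional : Carrier → Set (a ⊔ e)
  ZeroDimensional x = Empty (Δ x)

record _≅_ {I : Set a} {c₁ e₁ c₂ e₂} (A : Algebra I c₁ e₁) (B : Algebra I c₂ e₂)
         : Set (a ⊔ c₁ ⊔ e₁ ⊔ c₂ ⊔ e₂) where
  private
    module A = Algebra A
    module B = Algebra B
  field
    to        : A.Carrier → B.Carrier
    cong      : ∀ {x y} → x A.≈ y → to x B.≈ to y
    bijective : Bijective A._≈_ B._≈_ to
    ·-homo    : ∀ x y → to (x A.· y) B.≈ to x B.· to y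
    +-homo    : ∀ x y → to (x A.+ y) B.≈ to x B.+ to y
    -‿homo    : ∀ x → to (A.- x) B.≈ B.- to x
    𝟘-homo    : to A.𝟘 B.≈ B.𝟘
    𝟙-homo    : to A.𝟙 B.≈ B.𝟙
    cyl-homo  : ∀ i x → to (A.cyl i x) B.≈ B.cyl i (to x)

record Subuniverse {I : Set a} (A : Algebra I c e) (p : Level)
         : Set (a ⊔ c ⊔ e ⊔ suc p) where
  open Algebra A
  field
    member     : Pred Carrier p
    resp       : member Respects _≈_
    ·-closed   : ∀ {x y} → x ∈ member → y ∈ member → x · y ∈ member
    +-closed   : ∀ {x y} → x ∈ member → y ∈ member → x + y ∈ member
    -‿closed   : ∀ {x} → x ∈ member → - x ∈ member
    𝟘-closed   : 𝟘 ∈ member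
    𝟙-closed   : 𝟙 ∈ member
    cyl-closed : ∀ i {x} → x ∈ member → cyl i x ∈ member

subalgebra : {I : Set a} (A : Algebra I c e) → Subuniverse A p → Algebra I (c ⊔ p) e
subalgebra A S = record
  { Carrier       = Σ Carrier member
  ; _≈_           = λ x y → proj₁ x ≈ proj₁ y
  ; _·_           = λ (x , x∈) (y , y∈) → x · y , ·-closed x∈ y∈
  ; _+_           = λ (x , x∈) (y , y∈) → x + y , +-closed x∈ y∈
  ; -_            = λ (x , x∈) → - x , -‿closed x∈
  ; 𝟘             = 𝟘 , 𝟘-closed
  ; 𝟙             = 𝟙 , 𝟙-closed
  ; cyl           = λ i (x , x∈) → cyl i x , cyl-closed i x∈
  ; isEquivalence = record { refl = Eq.refl ; sym = λ p → Eq.sym p ; trans = λ p q → Eq.trans p q }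
  ; ·-cong        = λ p q → ·-cong p q
  ; +-cong        = λ p q → +-cong p q
  ; -‿cong        = λ p → -‿cong p
  ; cyl-cong      = λ i → cyl-cong i
  }
  where
  open Algebra A
  open Subuniverse S
  module Eq = IsEquivalence isEquivalence

-- Sequences are identified when pointwise equal, so
-- every set of sequences is required to respect _≗_; this stands in for
-- function extensionality.
module _ {ℓ} {I : Set ℓ} {U : Set ℓ} where

  _≡[_]_ : (I → U) → I → (I → U) → Set ℓ
  f ≡[ i ] g = ∀ j → j ≢ i → f j ≡ g j

  record SeqSet : Set (suc ℓ) where
    field
      ⟨_⟩  : Pred (I → U) ℓ
      resp : ⟨_⟩ Respects _≗_

  open SeqSet public using (⟨_⟩)

  record Subset (V : SeqSet) : Set (suc ℓ) where
    field
      seqSet : SeqSet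
      ⊆-unit : ⟨ seqSet ⟩ ⊆ ⟨ V ⟩

    elems : Pred (I → U) ℓ
    elems = ⟨ seqSet ⟩

  open Subset public using (elems)

  𝔓 : SeqSet → Algebra I (suc ℓ) ℓ
  𝔓 V = record
    { Carrier       = Subset V
    ; _≈_           = λ Y Z → elems Y ≐ elems Z
    ; _·_           = λ Y Z → record
        { seqSet = record
            { ⟨_⟩  = λ f → f ∈ elems Y × f ∈ elems Z
            ; resp = λ f≗g (y , z) → resp Y f≗g y , resp Z f≗g z }
        ; ⊆-unit = λ (y , _) → Subset.⊆-unit Y y }
    ; _+_           = λ Y Z → record
        { seqSet = record
            { ⟨_⟩  = λ f → f ∈ elems Y ⊎ f ∈ elems Z
            ; resp = λ { f≗g (inj₁ y) → inj₁ (resp Y f≗g y)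
                       ; f≗g (inj₂ z) → inj₂ (resp Z f≗g z) } }
        ; ⊆-unit = λ { (inj₁ y) → Subset.⊆-unit Y y
                     ; (inj₂ z) → Subset.⊆-unit Z z } }
    ; -_            = λ Y → record
        { seqSet = record
            { ⟨_⟩  = λ f → f ∈ ⟨ V ⟩ × f ∉ elems Y
            ; resp = λ f≗g (v , f∉Y) →
                SeqSet.resp V f≗g v , f∉Y ∘ resp Y (sym ∘ f≗g) }
        ; ⊆-unit = proj₁ }
    ; 𝟘             = record
        { seqSet = record { ⟨_⟩ = λ _ → ⊥ ; resp = λ _ () }
        ; ⊆-unit = λ () }
    ; 𝟙             = record { seqSet = V ; ⊆-unit = λ v → v }
    ; cyl           = λ i Y → record
        { seqSet = record
            { ⟨_⟩  = λ f → f ∈ ⟨ V ⟩ × ∃[ g ] (g ∈ elems Y × f ≡[ i ] g)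
            ; resp = λ f≗f′ (v , g , g∈Y , f≡g) →
                SeqSet.resp V f≗f′ v , g , g∈Y ,
                λ j j≢i → trans (sym (f≗f′ j)) (f≡g j j≢i) }
        ; ⊆-unit = proj₁ }
    ; isEquivalence = record
        { refl  = (λ y → y) , (λ y → y)
        ; sym   = λ (s , t) → t , s
        ; trans = λ (s , t) (s′ , t′) → (λ y → s′ (s y)) , (λ z → t (t′ z)) }
    ; ·-cong        = λ (s , t) (s′ , t′) →
        (λ (y , z) → s y , s′ z) , (λ (y , z) → t y , t′ z)
    ; +-cong        = λ (s , t) (s′ , t′) →
        (λ { (inj₁ y) → inj₁ (s y) ; (inj₂ z) → inj₂ (s′ z) }) ,
        (λ { (inj₁ y) → inj₁ (t y) ; (inj₂ z) → inj₂ (t′ z) })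
    ; -‿cong        = λ (s , t) →
        (λ (v , n) → v , λ z → n (t z)) , (λ (v , n) → v , λ y → n (s y))
    ; cyl-cong      = λ i (s , t) →
        (λ (v , g , g∈ , eq) → v , g , s g∈ , eq) ,
        (λ (v , g , g∈ , eq) → v , g , t g∈ , eq)
    }
    where
    resp : (Y : Subset V) → elems Y Respects _≗_
    resp Y = SeqSet.resp (Subset.seqSet Y)

Drs : ∀ {ℓ} (α : Ordinal ℓ) → Algebra (Index α) (suc ℓ) ℓ → Set (suc (suc ℓ))
Drs {ℓ} α A =
  Σ (Set ℓ) λ U →
  Σ (SeqSet {I = Index α} {U = U}) λ V →
  Satisfiable ⟨ V ⟩ ×
  Σ (Subuniverse (𝔓 V) (suc ℓ)) λ S →
  A ≅ subalgebra (𝔓 V) S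

data Term (I : Set a) (X : Set x) : Set (a ⊔ x) where
  var     : X → Term I X
  _·_ _+_ : Term I X → Term I X → Term I X
  -_      : Term I X → Term I X
  𝟘 𝟙     : Term I X
  cyl     : I → Term I X → Term I X

module _ {I : Set a} {X : Set x} (A : Algebra I c e) where
  private module A = Algebra A

  ⟦_⟧ : Term I X → (X → A.Carrier) → A.Carrier
  ⟦ var v ⟧   ρ = ρ v
  ⟦ s · t ⟧   ρ = ⟦ s ⟧ ρ A.· ⟦ t ⟧ ρ
  ⟦ s + t ⟧   ρ = ⟦ s ⟧ ρ A.+ ⟦ t ⟧ ρ
  ⟦ - s ⟧     ρ = A.- ⟦ s ⟧ ρ
  ⟦ 𝟘 ⟧       ρ = A.𝟘
  ⟦ 𝟙 ⟧       ρ = A.𝟙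
  ⟦ cyl i s ⟧ ρ = A.cyl i (⟦ s ⟧ ρ)

  _⊨_≈_ : Term I X → Term I X → Set (c ⊔ e ⊔ x)
  _⊨_≈_ s t = ∀ ρ → ⟦ s ⟧ ρ A.≈ ⟦ t ⟧ ρ

Drs⊨_≈_ : ∀ {ℓ} {α : Ordinal ℓ} {X : Set x} → Rel (Term (Index α) X) (suc (suc ℓ) ⊔ x)
Drs⊨_≈_ {α = α} s t = ∀ A → Drs α A → A ⊨ s ≈ t

𝔉𝔯 : ∀ {ℓ} (X : Set x) (α : Ordinal ℓ) → Algebra (Index α) (ℓ ⊔ x) (suc (suc ℓ) ⊔ x)
𝔉𝔯 X α = record
  { Carrier       = Term (Index α) X
  ; _≈_           = Drs⊨_≈_ {α = α}
  ; _·_           = _·_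
  ; _+_           = _+_
  ; -_            = -_
  ; 𝟘             = 𝟘
  ; 𝟙             = 𝟙
  ; cyl           = cyl
  ; isEquivalence = record
      { refl  = λ A _ ρ → IsEquivalence.refl (Algebra.isEquivalence A)
      ; sym   = λ p A d ρ → IsEquivalence.sym (Algebra.isEquivalence A) (p A d ρ)
      ; trans = λ p q A d ρ →
          IsEquivalence.trans (Algebra.isEquivalence A) (p A d ρ) (q A d ρ) }
  ; ·-cong        = λ p q A d ρ → Algebra.·-cong A (p A d ρ) (q A d ρ)
  ; +-cong        = λ p q A d ρ → Algebra.+-cong A (p A d ρ) (q A d ρ)
  ; -‿cong        = λ p A d ρ → Algebra.-‿cong A (p A d ρ)
  ; cyl-cong      = λ i p A d ρ → Algebra.cyl-cong A i (p A d ρ)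
  }

{-# OPTIONS --safe #-}
-- Suppose t is zero-dimensional, holds at a point f of a model on V and fails
-- at a point f′ of a model on V′.  Let W ⊆ ᵅℕ be a staircase whose steps change
-- the coordinates i₀ and i₁ alternately.  The projections of the unit V × V′ × W
-- to V and V′ are bounded morphisms, and a move along any ≡ᵢ changes the height
-- on the staircase by at most one.  Interpret the variables as in V up to a
-- certain height and as in V′ above it.  The truth of t at a point depends only
-- on the points reachable in at most (nesting depth of the cylindrifications of
-- t) moves, so t holds above f at the bottom and fails above f′ far up.
-- But zero-dimensionality makes t constant along the staircase.
module Submission where

open import Defs using (Ordinal; _≤ₒ_; finₒ; Algebra; 𝔉𝔯)
open import Axiom.ExcludedMiddle using (ExcludedMiddle)
open import Data.Sum using (_⊎_)
open import Function.Bundles using (_⇔_)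

open import Axiom.DoubleNegationElimination using (em⇒dne)
open import Data.Fin using (zero; suc)
open import Data.Nat as ℕ using (ℕ; zero; suc; _≤_; _<_; _⊔_; z≤n; s≤s)
open import Data.Nat.Properties as ℕ using (module ≤-Reasoning)
open import Data.Product using (Σ; ∃-syntax; _×_; _,_; proj₁; proj₂)
open import Data.Product.Function.NonDependent.Propositional using (_×-⇔_)
open import Data.Sum using (inj₁; inj₂)
open import Data.Sum.Function.Propositional using (_⊎-⇔_)
open import Data.Unit.Polymorphic using (⊤)
open import Defs
  using ( _≅_; Subuniverse; subalgebra; _≡[_]_; SeqSet; ⟨_⟩; Subset; elems; 𝔓; Drs
        ; Term; var; _·_; _+_; -_; cyl; ⟦_⟧; _⊨_≈_; Drs⊨_≈_ )
open import Function using (_∘_; id; mk⇔)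
open import Function.Bundles using (Equivalence)
open import Level using (Level) renaming (suc to lsuc; _⊔_ to _⊔ℓ_)
open import Relation.Binary using (IsEquivalence; IsStrictTotalOrder; DecidableEquality)
open import Relation.Binary.PropositionalEquality
  using (_≡_; _≢_; _≗_; refl; sym; trans; cong; cong₂; subst; subst₂)
open import Relation.Nullary using (¬_; yes; no; contradiction)
open import Relation.Unary using (_∈_; Satisfiable)

private
  variable
    a c e p x ℓ : Level

-- Nesting depth; equations under isomorphisms and subalgebras.

module _ {I : Set a} {X : Set x} where

  depth : Term I X → ℕ
  depth (var _)   = 0
  depth (s · t)   = depth s ⊔ depth t
  depth (s + t)   = depth s ⊔ depth t
  depth (- s)     = depth s
  depth Term.𝟘    = 0
  depth Term.𝟙    = 0
  depth (cyl _ s) = suc (depth s)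

  module _ {c₁ e₁ c₂ e₂} {A : Algebra I c₁ e₁} {B : Algebra I c₂ e₂} (A≅B : A ≅ B) where
    private
      module A = Algebra A
      module B = Algebra B
      module BEq = IsEquivalence B.isEquivalence
    open _≅_ A≅B hiding (cong)

    ⟦⟧-homo : (t : Term I X) (ρ : X → A.Carrier) →
              to (⟦ A ⟧ t ρ) B.≈ ⟦ B ⟧ t (to ∘ ρ)
    ⟦⟧-homo (var v)   ρ = BEq.refl
    ⟦⟧-homo (s · t)   ρ = BEq.trans (·-homo _ _) (B.·-cong (⟦⟧-homo s ρ) (⟦⟧-homo t ρ))
    ⟦⟧-homo (s + t)   ρ = BEq.trans (+-homo _ _) (B.+-cong (⟦⟧-homo s ρ) (⟦⟧-homo t ρ))
    ⟦⟧-homo (- s)     ρ = BEq.trans (-‿homo _) (B.-‿cong (⟦⟧-homo s ρ))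
    ⟦⟧-homo Term.𝟘    ρ = 𝟘-homo
    ⟦⟧-homo Term.𝟙    ρ = 𝟙-homo
    ⟦⟧-homo (cyl i s) ρ = BEq.trans (cyl-homo i _) (B.cyl-cong i (⟦⟧-homo s ρ))

    ⊨-resp-≅ : ∀ s t → B ⊨ s ≈ t → A ⊨ s ≈ t
    ⊨-resp-≅ s t eq ρ = proj₁ bijective
      (BEq.trans (⟦⟧-homo s ρ) (BEq.trans (eq (to ∘ ρ)) (BEq.sym (⟦⟧-homo t ρ))))

  module _ (A : Algebra I c e) (S : Subuniverse A p) where
    private module A = Algebra A

    ⟦⟧-subalgebra : (t : Term I X) (ρ : X → Algebra.Carrier (subalgebra A S)) →
                    proj₁ (⟦ subalgebra A S ⟧ t ρ) ≡ ⟦ A ⟧ t (proj₁ ∘ ρ)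
    ⟦⟧-subalgebra (var v)   ρ = refl
    ⟦⟧-subalgebra (s · t)   ρ = cong₂ A._·_ (⟦⟧-subalgebra s ρ) (⟦⟧-subalgebra t ρ)
    ⟦⟧-subalgebra (s + t)   ρ = cong₂ A._+_ (⟦⟧-subalgebra s ρ) (⟦⟧-subalgebra t ρ)
    ⟦⟧-subalgebra (- s)     ρ = cong A.-_ (⟦⟧-subalgebra s ρ)
    ⟦⟧-subalgebra Term.𝟘    ρ = refl
    ⟦⟧-subalgebra Term.𝟙    ρ = refl
    ⟦⟧-subalgebra (cyl i s) ρ = cong (A.cyl i) (⟦⟧-subalgebra s ρ)

    ⊨-subalgebra : ∀ s t → A ⊨ s ≈ t → subalgebra A S ⊨ s ≈ t
    ⊨-subalgebra s t eq ρ =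
      subst₂ A._≈_ (sym (⟦⟧-subalgebra s ρ)) (sym (⟦⟧-subalgebra t ρ)) (eq (proj₁ ∘ ρ))

-- Reduction of validity in the class to the full algebras `𝔓 V`.

module _ {α : Ordinal ℓ} where
  open Ordinal α using (Index)

  𝔓∈Drs : {U : Set ℓ} (V : SeqSet {I = Index} {U = U}) → Satisfiable ⟨ V ⟩ → Drs α (𝔓 V)
  𝔓∈Drs V V≢∅ = _ , V , V≢∅ , full , record
    { to        = _, _
    ; cong      = id
    ; bijective = id , λ (y , _) → y , id
    ; ·-homo    = λ _ _ → id , id
    ; +-homo    = λ _ _ → id , id
    ; -‿homo    = λ _ → id , id
    ; 𝟘-homo    = id , id
    ; 𝟙-homo    = id , id
    ; cyl-homo  = λ _ _ → id , id
    }
    where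
    full : Subuniverse (𝔓 V) (lsuc ℓ)
    full = record { member = λ _ → ⊤ }

  -- Equations pass from `𝔓 V` to its subalgebras and from there to isomorphic copies, so later
  -- arguments can work with points of `V` directly.
  𝔓⊨⇒Drs⊨ : {X : Set x} (s t : Term Index X) →
    (∀ {U} (V : SeqSet {I = Index} {U = U}) → 𝔓 V ⊨ s ≈ t) → Drs⊨_≈_ {α = α} s t
  𝔓⊨⇒Drs⊨ s t valid A (_ , V , _ , S , A≅) =
    ⊨-resp-≅ A≅ s t (⊨-subalgebra (𝔓 V) S s t (valid V))

-- Models and bounded bisimulations.

record Model (I : Set ℓ) (X : Set x) : Set (lsuc ℓ ⊔ℓ x) where
  field
    {U}   : Set ℓ
    unit  : SeqSet {I = I} {U = U}
    ρ     : X → Subset unit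

  Point : Set ℓ
  Point = I → U

  infix 4 _⊩_
  _⊩_ : Point → Term I X → Set ℓ
  f ⊩ t = f ∈ elems (⟦ 𝔓 unit ⟧ t ρ)

module _ {I : Set ℓ} {X : Set x} where

  SatisfiableTerm : Term I X → Set (lsuc ℓ ⊔ℓ x)
  SatisfiableTerm t = Σ (Model I X) λ M → ∃[ f ] Model._⊩_ M f t

  -- These are the bounded bisimulations of modal logic, with the relations `≡[ i ]` between points
  -- of the unit as accessibility. The index `n` counts the moves that remain.
  record BoundedBisimulation (M N : Model I X) : Set (lsuc ℓ ⊔ℓ x) where
    private
      module M = Model M
      module N = Model N
    field
      _∼[_]_ : M.Point → ℕ → N.Point → Set ℓ
      unitˡ  : ∀ {n f g} → f ∼[ n ] g → f ∈ ⟨ M.unit ⟩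
      unitʳ  : ∀ {n f g} → f ∼[ n ] g → g ∈ ⟨ N.unit ⟩
      atom   : ∀ {n f g} → f ∼[ n ] g → ∀ v → f M.⊩ var v ⇔ g N.⊩ var v
      forth  : ∀ {n f g} → f ∼[ suc n ] g → ∀ {i f′} → f′ ∈ ⟨ M.unit ⟩ → f ≡[ i ] f′ →
               ∃[ g′ ] (g ≡[ i ] g′ × f′ ∼[ n ] g′)
      back   : ∀ {n f g} → f ∼[ suc n ] g → ∀ {i g′} → g′ ∈ ⟨ N.unit ⟩ → g ≡[ i ] g′ →
               ∃[ f′ ] (f ≡[ i ] f′ × f′ ∼[ n ] g′)

    -- A cylindrification costs one move and the Boolean operations cost none. Complements and
    -- cylinders are taken inside the unit, so their cases also need `unitˡ` and `unitʳ`.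
    invariance : ∀ {n f g} → f ∼[ n ] g → ∀ t → depth t ≤ n → f M.⊩ t ⇔ g N.⊩ t
    invariance f∼g (var v) _ = atom f∼g v
    invariance f∼g (s · t) d =
      invariance f∼g s (ℕ.m⊔n≤o⇒m≤o (depth s) _ d) ×-⇔ invariance f∼g t (ℕ.m⊔n≤o⇒n≤o (depth s) _ d)
    invariance f∼g (s + t) d =
      invariance f∼g s (ℕ.m⊔n≤o⇒m≤o (depth s) _ d) ⊎-⇔ invariance f∼g t (ℕ.m⊔n≤o⇒n≤o (depth s) _ d)
    invariance f∼g (- s) d = mk⇔
      (λ (_ , f⊮s) → unitʳ f∼g , f⊮s ∘ from)
      (λ (_ , g⊮s) → unitˡ f∼g , g⊮s ∘ to)
      where open Equivalence (invariance f∼g s d)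
    invariance f∼g Term.𝟘 _ = mk⇔ (λ ()) (λ ())
    invariance f∼g Term.𝟙 _ = mk⇔ (λ _ → unitʳ f∼g) (λ _ → unitˡ f∼g)
    invariance f∼g (cyl i s) (s≤s d) = mk⇔
      (λ (_ , f′ , f′⊩s , f≡f′) →
        let g′ , g≡g′ , f′∼g′ = forth f∼g (Subset.⊆-unit (⟦ 𝔓 M.unit ⟧ s M.ρ) f′⊩s) f≡f′
        in unitʳ f∼g , g′ , Equivalence.to (invariance f′∼g′ s d) f′⊩s , g≡g′)
      (λ (_ , g′ , g′⊩s , g≡g′) →
        let f′ , f≡f′ , f′∼g′ = back f∼g (Subset.⊆-unit (⟦ 𝔓 N.unit ⟧ s N.ρ) g′⊩s) g≡g′
        in unitˡ f∼g , f′ , Equivalence.from (invariance f′∼g′ s d) g′⊩s , f≡f′)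

-- The staircase.

module Staircase {I : Set ℓ} (_≟_ : DecidableEquality I) {i₀ i₁ : I} (i₀≢i₁ : i₀ ≢ i₁) where

  -- Each of the coordinates `i₀` and `i₁` confines the other to two adjacent values; all other
  -- coordinates are free.
  Stair : (I → ℕ) → Set
  Stair w = w i₁ ≤ w i₀ × w i₀ ≤ suc (w i₁)

  Stair-resp : ∀ {w w′} → w ≗ w′ → Stair w → Stair w′
  Stair-resp w≗w′ (lo , hi) =
    subst₂ _≤_ (w≗w′ i₁) (w≗w′ i₀) lo , subst₂ _≤_ (w≗w′ i₀) (cong suc (w≗w′ i₁)) hi

  -- A move along `i₀` keeps the value at `i₁`, which leaves only two adjacent values for `i₀`; any
  -- other move keeps the value at `i₀` itself.
  step-≤ : ∀ {w w′} → Stair w → Stair w′ → ∀ {i} → (∀ j → j ≢ i → w j ≡ w′ j) →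
           w′ i₀ ≤ suc (w i₀)
  step-≤ {w} {w′} (lo , _) (_ , hi′) {i} w≡w′ with i₀ ≟ i
  ... | no  i₀≢i = ℕ.≤-trans (ℕ.≤-reflexive (sym (w≡w′ i₀ i₀≢i))) (ℕ.n≤1+n _)
  ... | yes refl = begin
    w′ i₀       ≤⟨ hi′ ⟩
    suc (w′ i₁) ≡⟨ cong suc (w≡w′ i₁ (i₀≢i₁ ∘ sym)) ⟨
    suc (w i₁)  ≤⟨ s≤s lo ⟩
    suc (w i₀)  ∎
    where open ≤-Reasoning

  stair : ℕ → ℕ → I → ℕ
  stair m n j with j ≟ i₀ | j ≟ i₁
  ... | yes _ | _     = m
  ... | no _  | yes _ = n
  -- Any constant would do here: two stairs only have to agree off `i₀` and `i₁`.
  ... | no _  | no _  = 0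

  stair-i₀ : ∀ m n → stair m n i₀ ≡ m
  stair-i₀ m n with i₀ ≟ i₀
  ... | yes _     = refl
  ... | no  i₀≢i₀ = contradiction refl i₀≢i₀

  stair-i₁ : ∀ m n → stair m n i₁ ≡ n
  stair-i₁ m n with i₁ ≟ i₀ | i₁ ≟ i₁
  ... | yes i₁≡i₀ | _         = contradiction (sym i₁≡i₀) i₀≢i₁
  ... | no  _     | yes _     = refl
  ... | no  _     | no  i₁≢i₁ = contradiction refl i₁≢i₁

  stair-≡[i₀] : ∀ m m′ n j → j ≢ i₀ → stair m n j ≡ stair m′ n j
  stair-≡[i₀] m m′ n j j≢i₀ with j ≟ i₀ | j ≟ i₁
  ... | yes j≡i₀ | _     = contradiction j≡i₀ j≢i₀
  ... | no _     | yes _ = refl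
  ... | no _     | no _  = refl

  stair-≡[i₁] : ∀ m n n′ j → j ≢ i₁ → stair m n j ≡ stair m n′ j
  stair-≡[i₁] m n n′ j j≢i₁ with j ≟ i₀ | j ≟ i₁
  ... | yes _ | _        = refl
  ... | no _  | yes j≡i₁ = contradiction j≡i₁ j≢i₁
  ... | no _  | no _     = refl

  stair∈ : ∀ {m n} → n ≤ m → m ≤ suc n → Stair (stair m n)
  stair∈ {m} {n} lo hi rewrite stair-i₀ m n | stair-i₁ m n = lo , hi

  -- Gluing two models along the staircase.

  module _ {X : Set x} (M M′ : Model I X) (N : ℕ) where
    private
      module M  = Model M
      module M′ = Model M′

    Base : Set ℓ
    Base = M.U × M′.U × ℕ

    fst : (I → Base) → M.Point
    fst h = proj₁ ∘ h

    snd : (I → Base) → M′.Point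
    snd h = proj₁ ∘ proj₂ ∘ h

    stage : (I → Base) → I → ℕ
    stage h = proj₂ ∘ proj₂ ∘ h

    height : (I → Base) → ℕ
    height h = stage h i₀

    productUnit : SeqSet {I = I} {U = Base}
    productUnit = record
      { ⟨_⟩  = λ h → fst h ∈ ⟨ M.unit ⟩ × snd h ∈ ⟨ M′.unit ⟩ × Stair (stage h)
      ; resp = λ h≗h′ (v , v′ , w) →
          SeqSet.resp M.unit (cong proj₁ ∘ h≗h′) v ,
          SeqSet.resp M′.unit (cong (proj₁ ∘ proj₂) ∘ h≗h′) v′ ,
          Stair-resp (cong (proj₂ ∘ proj₂) ∘ h≗h′) w
      }

    glue : Model I X
    glue = record
      { unit = productUnit
      ; ρ    = λ v → record
          { seqSet = record
              { ⟨_⟩  = λ h → h ∈ ⟨ productUnit ⟩ ×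
                  (height h ≤ N × fst h M.⊩ var v ⊎ N < height h × snd h M′.⊩ var v)
              ; resp = λ
                  { h≗h′ (u , inj₁ (low , b)) → SeqSet.resp productUnit h≗h′ u ,
                      inj₁ ( subst (_≤ N) (cong (proj₂ ∘ proj₂) (h≗h′ i₀)) low
                           , SeqSet.resp (Subset.seqSet (M.ρ v)) (cong proj₁ ∘ h≗h′) b)
                  ; h≗h′ (u , inj₂ (high , b)) → SeqSet.resp productUnit h≗h′ u ,
                      inj₂ ( subst (N <_) (cong (proj₂ ∘ proj₂) (h≗h′ i₀)) high
                           , SeqSet.resp (Subset.seqSet (M′.ρ v)) (cong (proj₁ ∘ proj₂) ∘ h≗h′) b) }
              }
          ; ⊆-unit = proj₁
          }
      }

    module G = Model glue

    height-step : ∀ {h h′ i} → h ∈ ⟨ productUnit ⟩ → h′ ∈ ⟨ productUnit ⟩ → h ≡[ i ] h′ →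
                  height h′ ≤ suc (height h)
    height-step (_ , _ , w) (_ , _ , w′) h≡h′ =
      step-≤ w w′ (λ j j≢i → cong (proj₂ ∘ proj₂) (h≡h′ j j≢i))

    -- If `n + height h ≤ N`, then `n` moves cannot lead above `N`, where the variables would be
    -- read in `M′`. A move in `M` lifts to the product by keeping the other two components.
    low-bisimulation : BoundedBisimulation glue M
    low-bisimulation = record
      { _∼[_]_ = λ h n f → h ∈ ⟨ productUnit ⟩ × n ℕ.+ height h ≤ N × fst h ≡ f
      ; unitˡ  = proj₁
      ; unitʳ  = λ { ((v , _) , _ , refl) → v }
      ; atom   = λ { {n} (u , bound , refl) v → mk⇔
          (λ { (_ , inj₁ (_ , b))    → b
             ; (_ , inj₂ (high , _)) →
                 contradiction (ℕ.m+n≤o⇒n≤o n bound) (ℕ.<⇒≱ high) })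
          (λ b → u , inj₁ (ℕ.m+n≤o⇒n≤o n bound , b)) }
      ; forth  = λ { (u , bound , refl) u′ h≡h′ →
          _ , (λ j j≢i → cong proj₁ (h≡h′ j j≢i)) , u′ , lower u u′ h≡h′ bound , refl }
      ; back   = λ { {f = h} (u@(_ , v′ , w) , bound , refl) {g′ = f′} v f≡f′ →
          let h≡h′ = λ j j≢i → cong (_, proj₂ (h j)) (f≡f′ j j≢i)
          in (λ j → f′ j , proj₂ (h j)) , h≡h′ ,
             (v , v′ , w) , lower u (v , v′ , w) h≡h′ bound , refl }
      }
      where
      lower : ∀ {n h h′ i} → h ∈ ⟨ productUnit ⟩ → h′ ∈ ⟨ productUnit ⟩ → h ≡[ i ] h′ →
              suc n ℕ.+ height h ≤ N → n ℕ.+ height h′ ≤ N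
      lower {n} {h} {h′} u u′ h≡h′ bound = begin
        n ℕ.+ height h′      ≤⟨ ℕ.+-monoʳ-≤ n (height-step u u′ h≡h′) ⟩
        n ℕ.+ suc (height h) ≡⟨ ℕ.+-suc n _ ⟩
        suc n ℕ.+ height h   ≤⟨ bound ⟩
        N                    ∎
        where open ≤-Reasoning

    -- The mirror image: if `n + N < height h`, then `n` moves cannot lead down to `N`, which still
    -- counts as low.
    high-bisimulation : BoundedBisimulation glue M′
    high-bisimulation = record
      { _∼[_]_ = λ h n f → h ∈ ⟨ productUnit ⟩ × n ℕ.+ N < height h × snd h ≡ f
      ; unitˡ  = proj₁
      ; unitʳ  = λ { ((_ , v′ , _) , _ , refl) → v′ }
      ; atom   = λ { {n} (u , bound , refl) v → mk⇔
          (λ { (_ , inj₁ (low , _)) →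
                 contradiction (ℕ.≤-<-trans (ℕ.m≤n+m N n) bound) (ℕ.≤⇒≯ low)
             ; (_ , inj₂ (_ , b))   → b })
          (λ b → u , inj₂ (ℕ.≤-<-trans (ℕ.m≤n+m N n) bound , b)) }
      ; forth  = λ { (u , bound , refl) u′ h≡h′ →
          _ , (λ j j≢i → cong (proj₁ ∘ proj₂) (h≡h′ j j≢i)) , u′ , raise u u′ h≡h′ bound , refl }
      ; back   = λ { {f = h} (u@(v , _ , w) , bound , refl) {g′ = f′} v′ f≡f′ →
          let h≡h′ = λ j j≢i → cong (λ y → proj₁ (h j) , y , stage h j) (f≡f′ j j≢i)
          in (λ j → proj₁ (h j) , f′ j , stage h j) , h≡h′ ,
             (v , v′ , w) , raise u (v , v′ , w) h≡h′ bound , refl }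
      }
      where
      raise : ∀ {n h h′ i} → h ∈ ⟨ productUnit ⟩ → h′ ∈ ⟨ productUnit ⟩ → h ≡[ i ] h′ →
              suc n ℕ.+ N < height h → n ℕ.+ N < height h′
      raise u u′ h≡h′ bound =
        -- `height-step` bounds a rise, so the fall is bounded as the rise of the reversed move.
        ℕ.≤-pred (ℕ.≤-trans bound (height-step u′ u (λ j j≢i → sym (h≡h′ j j≢i))))

    module _ {f f′} (f∈V : f ∈ ⟨ M.unit ⟩) (f′∈V′ : f′ ∈ ⟨ M′.unit ⟩) where

      at : ℕ → ℕ → I → Base
      at m n j = f j , f′ j , stair m n j

      at∈ : ∀ {m n} → n ≤ m → m ≤ suc n → at m n ∈ ⟨ productUnit ⟩
      at∈ lo hi = f∈V , f′∈V′ , stair∈ lo hi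

      climb : {P : G.Point → Set ℓ} →
              (∀ i {h h′} → h′ ∈ ⟨ productUnit ⟩ → h′ ≡[ i ] h → P h → P h′) →
              P (at 0 0) → ∀ m → P (at m m)
      climb move p₀ zero    = p₀
      climb move p₀ (suc m) =
        -- The moves are applied from the inside out: `i₀` rises first and `i₁` follows. The
        -- opposite order would leave the staircase.
        move i₁ (at∈ ℕ.≤-refl (ℕ.n≤1+n _))
          (λ j j≢i₁ → cong (λ k → f j , f′ j , k) (stair-≡[i₁] (suc m) (suc m) m j j≢i₁))
        (move i₀ (at∈ (ℕ.n≤1+n _) ℕ.≤-refl)
          (λ j j≢i₀ → cong (λ k → f j , f′ j , k) (stair-≡[i₀] (suc m) m m j j≢i₀))
        (climb move p₀ m))

  -- Truth of `t` is carried from `f` in `M` to the bottom of the glued model, up the staircase by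
  -- closure under each cylindrification, and from the top to `f′` in `M′`.
  constant⇒⊩ : {X : Set x} (t : Term I X) →
    (∀ i (M : Model I X) {f} → Model._⊩_ M f (cyl i t) → Model._⊩_ M f t) →
    (M M′ : Model I X) → ∀ {f f′} → Model._⊩_ M f t → f′ ∈ ⟨ Model.unit M′ ⟩ →
    Model._⊩_ M′ f′ t
  constant⇒⊩ t closed M M′ {f} {f′} f⊩t f′∈V′ = Equivalence.to
    (invariance (high-bisimulation M M′ N)
      (at∈ M M′ N f∈V f′∈V′ ℕ.≤-refl (ℕ.n≤1+n _)
      , ℕ.≤-reflexive (sym (stair-i₀ top top)) , refl)
      t ℕ.≤-refl)
    (climb M M′ N f∈V f′∈V′ {P = λ h → Model._⊩_ (glue M M′ N) h t}
      (λ i {h} h′∈ h′≡h h⊩t → closed i (glue M M′ N) (h′∈ , h , h⊩t , h′≡h))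
      (Equivalence.from
        (invariance (low-bisimulation M M′ N)
          (at∈ M M′ N f∈V f′∈V′ z≤n z≤n
          , ℕ.≤-reflexive (trans (cong (N ℕ.+_) (stair-i₀ 0 0)) (ℕ.+-identityʳ N)) , refl)
          t ℕ.≤-refl)
        f⊩t)
      top)
    where
    open BoundedBisimulation
    N top : ℕ
    -- Evaluating `t` takes at most `N` moves. From height 0 these stay within `N`; `suc (N + N)` is
    -- the least height that satisfies the bound of `high-bisimulation` for `N` moves.
    N   = depth t
    top = suc (N ℕ.+ N)
    f∈V : f ∈ ⟨ Model.unit M ⟩
    f∈V = Subset.⊆-unit (⟦ 𝔓 (Model.unit M) ⟧ t (Model.ρ M)) f⊩t

-- Zero-dimensional elements of the free algebra.

module _ (α : Ordinal ℓ) (X : Set x) where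
  open Ordinal α using (Index)
  open Algebra (𝔉𝔯 X α) using (_≈_)
  private
    module Eq = IsEquivalence (Algebra.isEquivalence (𝔉𝔯 X α))

  cyl-𝟘 : ∀ i → cyl i Term.𝟘 ≈ Term.𝟘
  cyl-𝟘 i = 𝔓⊨⇒Drs⊨ {α = α} (cyl i Term.𝟘) Term.𝟘 λ V ρ → (λ { (_ , _ , () , _) }) , λ ()

  cyl-𝟙 : ∀ i → cyl i Term.𝟙 ≈ Term.𝟙
  cyl-𝟙 i = 𝔓⊨⇒Drs⊨ {α = α} (cyl i Term.𝟙) Term.𝟙 λ V ρ → proj₁ , λ v → v , _ , v , λ _ _ → refl

  cyl-fixed-resp-≈ : ∀ {i s t} → t ≈ s → cyl i s ≈ s → cyl i t ≈ t
  cyl-fixed-resp-≈ {i} {s} {t} t≈s cs≈s =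
    Eq.trans {cyl i t} {cyl i s} {t} (Algebra.cyl-cong (𝔉𝔯 X α) i {t} {s} t≈s)
      (Eq.trans {cyl i s} {s} {t} cs≈s (Eq.sym {t} {s} t≈s))

  ¬satisfiable⇒≈𝟘 : (t : Term Index X) → ¬ SatisfiableTerm t → t ≈ Term.𝟘
  ¬satisfiable⇒≈𝟘 t unsat = 𝔓⊨⇒Drs⊨ {α = α} t Term.𝟘 λ V ρ →
    (λ {f} f⊩t → contradiction (record { unit = V ; ρ = ρ } , f , f⊩t) unsat) , λ ()

  ¬refutable⇒≈𝟙 : (∀ {κ} → ExcludedMiddle κ) →
                  (t : Term Index X) → ¬ SatisfiableTerm (- t) → t ≈ Term.𝟙
  ¬refutable⇒≈𝟙 em t irref = 𝔓⊨⇒Drs⊨ {α = α} t Term.𝟙 λ V ρ →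
    Subset.⊆-unit (⟦ 𝔓 V ⟧ t ρ) ,
    λ {f} v → em⇒dne em λ f⊮t → irref (record { unit = V ; ρ = ρ } , f , v , f⊮t)

  -- The point `f` itself shows that the unit is nonempty, so `𝔓 V` belongs to the class and the
  -- equation applies to it.
  ≈⇒⊩ : ∀ s t → s ≈ t → (M : Model Index X) → ∀ {f} → Model._⊩_ M f s → Model._⊩_ M f t
  ≈⇒⊩ s t s≈t M {f} f⊩s = proj₁ (s≈t (𝔓 V) (𝔓∈Drs {α = α} V (f , v)) ρ) f⊩s
    where
    open Model M renaming (unit to V)
    v : f ∈ ⟨ V ⟩
    v = Subset.⊆-unit (⟦ 𝔓 V ⟧ s ρ) f⊩s

theorem3 : (∀ {κ} → ExcludedMiddle κ) →
    ∀ {ℓ x} (α : Ordinal ℓ) → finₒ 2 ≤ₒ α → (X : Set x) →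
    let open Algebra (𝔉𝔯 X α) in
    ∀ (t : Carrier) → ZeroDimensional t ⇔ (t ≈ 𝟘 ⊎ t ≈ 𝟙)
theorem3 em α 2≤α X t = mk⇔ only-if λ
  { (inj₁ t≈𝟘) i Δti → Δti (cyl-fixed-resp-≈ α X {s = Term.𝟘} {t} t≈𝟘 (cyl-𝟘 α X i))
  ; (inj₂ t≈𝟙) i Δti → Δti (cyl-fixed-resp-≈ α X {s = Term.𝟙} {t} t≈𝟙 (cyl-𝟙 α X i)) }
  where
  open Ordinal α using (isStrictTotalOrder)
  open IsStrictTotalOrder isStrictTotalOrder using (_≟_; irrefl)
  open _≤ₒ_ 2≤α using (embed; mono)
  open Algebra (𝔉𝔯 X α) using (_≈_; 𝟘; 𝟙; ZeroDimensional)

  0≢1 : embed zero ≢ embed (suc zero)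
  0≢1 eq = irrefl eq (mono (s≤s z≤n))

  open Staircase _≟_ 0≢1 using (constant⇒⊩)

  only-if : ZeroDimensional t → t ≈ 𝟘 ⊎ t ≈ 𝟙
  only-if Δt≡∅ with em {P = SatisfiableTerm t} | em {P = SatisfiableTerm (- t)}
  ... | no unsat | _        = inj₁ (¬satisfiable⇒≈𝟘 α X t unsat)
  ... | _        | no irref = inj₂ (¬refutable⇒≈𝟙 α X em t irref)
  ... | yes (M , _ , f⊩t) | yes (M′ , _ , f′∈V′ , f′⊮t) =
    contradiction
      -- Emptiness of `Δ t` gives `cyl i t ≈ t` only up to double negation, which excluded middle
      -- removes.
      (constant⇒⊩ t (λ i → ≈⇒⊩ α X (cyl i t) t (em⇒dne em (Δt≡∅ i))) M M′ f⊩t f′∈V′)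
      f′⊮t
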